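{- For every formula $\alpha\in F$: (i) if $\alpha$ is valid in the class $\mathfrak{F}_1$ of all $\hat N$-frames, then $\vdash_{\mathrm{ILM}}\alpha$; (ii) if $\alpha$ is valid in the class $\mathfrak{F}_1'$ of all $\hat N'$-frames, then $\vdash_{\mathrm{ILM}\text{ - }\vee}\alpha$.
   Context: The set $F$ of formulas of $\mathrm{ILM}$ is built from propositional variables and constants $\top,\bot$ with $\wedge,\vee,\rightarrow,\neg,\sim$; $\alpha\leftrightarrow\beta$ abbreviates $(\alpha\rightarrow\beta)\wedge(\beta\rightarrow\alpha)$. Axiom schemes of $\mathrm{ILM}$: (A1) $\alpha\rightarrow(\beta\rightarrow\alpha)$; (A2) $(\alpha\rightarrow(\beta\rightarrow\gamma))\rightarrow((\alpha\rightarrow\beta)\rightarrow(\alpha\rightarrow\gamma))$; (A3) $\alpha\rightarrow(\alpha\vee\beta)$, $\beta\rightarrow(\alpha\vee\beta)$; (A4) $(\alpha\rightarrow\gamma)\rightarrow((\beta\rightarrow\gamma)\rightarrow((\alpha\vee\beta)\rightarrow\gamma))$; (A5) $(\alpha\wedge\beta)\rightarrow\alpha$, $(\alpha\wedge\beta)\rightarrow\beta$; (A6) $(\alpha\rightarrow\beta)\rightarrow((\alpha\rightarrow\gamma)\rightarrow(\alpha\rightarrow(\beta\wedge\gamma)))$; (A7) $\alpha\rightarrow\top$; (A8) $\bot\rightarrow\alpha$; (A9) $(\alpha\rightarrow\beta)\rightarrow((\alpha\rightarrow\neg\beta)\rightarrow\neg\alpha)$; (A10) $\neg\alpha\rightarrow(\alpha\rightarrow\beta)$;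 (A11) $\sim\alpha\leftrightarrow(\alpha\rightarrow\neg\neg\sim\top)$. Modus ponens is the only rule. $\mathrm{ILM}$-$\vee$ is $\mathrm{ILM}$ plus the axiom scheme $\alpha\vee\sim\alpha$. A strictly condensed $J$-frame is a triple $(X,\leq,R_N)$ with $(X,\leq)$ a poset and $R_N$ a binary relation on $X$ such that: (i) $(\leq R_N\leq^{ -1})\subseteq R_N$, i.e. $x\leq x'$, $x'R_Ny'$, $y\leq y'$ imply $xR_Ny$; (ii) $R_N$ is symmetric; (iii) $\forall x,y\,(xR_Ny\Rightarrow\exists z(x\leq z\ \&\ y\leq z\ \&\ xR_Nz))$. It is a strictly condensed $H$-frame if moreover $R_N$ is reflexive. An $\hat N$-frame is $(X,\leq,R_{N_1},R_{N_2})$ such that (1) $(X,\leq,R_{N_1})$ is a strictly condensed $H$-frame; (2) $(X,\leq,R_{N_2})$ is a strictly condensed $J$-frame; (3) for all $x\in X$: if for every $y$ with $xR_{N_1}y$ there is $z$ with $yR_{N_1}z$ and no $z'$ with $zR_{N_2}z'$, then there is no $z''$ with $xR_{N_2}z''$. An $\hat N'$-frame is an $\hat N$-frame with $R_{N_2}\subseteq(\leq^{ -1})$, i.e. $xR_{N_2}y$ implies $y\leq x$. A valuation assigns to each propositional variable an upset (upward closed subset) of $X$. Truth at $x$: $x\vDash p$ iff $x\in v(p)$; $\top$ is true everywhere and $\bot$ nowhere; $\wedge,\vee$ pointwise; $x\vDash\alpha\rightarrow\beta$ iff for all $y\geq x$, $y\vDash\alpha$ implies $y\vDash\beta$; $x\vDash\neg\alpha$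 iff for all $y$, $xR_{N_1}y$ implies $y\nvDash\alpha$; $x\vDash\sim\alpha$ iff for all $y$, $xR_{N_2}y$ implies $y\nvDash\alpha$. A formula is valid in a class of frames if it is true at every point under every valuation on every frame in the class. -}

module Defs where

open import Data.Empty using (⊥)
open import Data.Nat using (ℕ)
open import Data.Product using (∃; _×_)
open import Data.Sum using (_⊎_)
open import Data.Unit using (⊤)
open import Function using (flip)
open import Level using (0ℓ)
open import Relation.Binary using (Rel; IsPartialOrder; Reflexive; Symmetric; _⇒_)
open import Relation.Binary.PropositionalEquality using (_≡_)
open import Relation.Nullary using (¬_)
open import Relation.Unary using (Pred; U)

infix  10 ¬ᶠ_ ∼_
infixr 8 _∧_
infixr 7 _∨_
infixr 6 _⟶_
infix  5 _⟷_

data Formula : Set where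
  var         : ℕ → Formula
  ⊤ᶠ ⊥ᶠ       : Formula
  _∧_ _∨_ _⟶_ : Formula → Formula → Formula
  ¬ᶠ_ ∼_      : Formula → Formula

_⟷_ : Formula → Formula → Formula
α ⟷ β = (α ⟶ β) ∧ (β ⟶ α)

data ILM : Pred Formula 0ℓ where
  A1  : ∀ α β → ILM (α ⟶ (β ⟶ α))
  A2  : ∀ α β γ → ILM ((α ⟶ (β ⟶ γ)) ⟶ ((α ⟶ β) ⟶ (α ⟶ γ)))
  A3ˡ : ∀ α β → ILM (α ⟶ (α ∨ β))
  A3ʳ : ∀ α β → ILM (β ⟶ (α ∨ β))
  A4  : ∀ α β γ → ILM ((α ⟶ γ) ⟶ ((β ⟶ γ) ⟶ ((α ∨ β) ⟶ γ)))
  A5ˡ : ∀ α β → ILM ((α ∧ β) ⟶ α)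
  A5ʳ : ∀ α β → ILM ((α ∧ β) ⟶ β)
  A6  : ∀ α β γ → ILM ((α ⟶ β) ⟶ ((α ⟶ γ) ⟶ (α ⟶ (β ∧ γ))))
  A7  : ∀ α → ILM (α ⟶ ⊤ᶠ)
  A8  : ∀ α → ILM (⊥ᶠ ⟶ α)
  A9  : ∀ α β → ILM ((α ⟶ β) ⟶ ((α ⟶ ¬ᶠ β) ⟶ ¬ᶠ α))
  A10 : ∀ α β → ILM (¬ᶠ α ⟶ (α ⟶ β))
  A11 : ∀ α → ILM (∼ α ⟷ (α ⟶ ¬ᶠ ¬ᶠ ∼ ⊤ᶠ))

data ILM-∨ : Pred Formula 0ℓ where
  ilm : ∀ {α} → ILM α → ILM-∨ α
  ∨-∼ : ∀ α → ILM-∨ (α ∨ ∼ α)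

infix 4 ⊢[_]_

-- A logic is given by its set of axioms; modus ponens is the only rule.
data ⊢[_]_ (Ax : Pred Formula 0ℓ) : Pred Formula 0ℓ where
  axiom : ∀ {α} → Ax α → ⊢[ Ax ] α
  mp    : ∀ {α β} → ⊢[ Ax ] (α ⟶ β) → ⊢[ Ax ] α → ⊢[ Ax ] β

record IsStrictlyCondensedJFrame {X : Set} (_≤_ R : Rel X 0ℓ) : Set where
  field
    isPartialOrder : IsPartialOrder _≡_ _≤_
    condensed      : ∀ {x x′ y y′} → x ≤ x′ → R x′ y′ → y ≤ y′ → R x y
    symmetric      : Symmetric R
    strict         : ∀ {x y} → R x y → ∃ λ z → x ≤ z × y ≤ z × R x z

record IsStrictlyCondensedHFrame {X : Set} (_≤_ R : Rel X 0ℓ) : Set where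
  field
    isStrictlyCondensedJFrame : IsStrictlyCondensedJFrame _≤_ R
    reflexive                 : Reflexive R

record N̂Frame : Set₁ where
  infix 4 _≤_ _R₁_ _R₂_
  field
    X         : Set
    _≤_       : Rel X 0ℓ
    _R₁_ _R₂_ : Rel X 0ℓ
    isHFrame₁ : IsStrictlyCondensedHFrame _≤_ _R₁_
    isJFrame₂ : IsStrictlyCondensedJFrame _≤_ _R₂_
    R₁-R₂     : ∀ x →
                (∀ y → x R₁ y → ∃ λ z → y R₁ z × ¬ (∃ λ z′ → z R₂ z′)) →
                ¬ (∃ λ z″ → x R₂ z″)

IsN̂′Frame : Pred N̂Frame 0ℓ
IsN̂′Frame 𝓕 = _R₂_ ⇒ flip _≤_
  where open N̂Frame 𝓕

record Valuation (𝓕 : N̂Frame) : Set₁ where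
  open N̂Frame 𝓕
  field
    V     : ℕ → Pred X 0ℓ
    upset : ∀ p {x y} → x ≤ y → V p x → V p y

module _ (𝓕 : N̂Frame) (v : Valuation 𝓕) where
  open N̂Frame 𝓕
  open Valuation v

  Truth : X → Formula → Set
  Truth x (var p) = V p x
  Truth x ⊤ᶠ      = ⊤
  Truth x ⊥ᶠ      = ⊥
  Truth x (α ∧ β) = Truth x α × Truth x β
  Truth x (α ∨ β) = Truth x α ⊎ Truth x β
  Truth x (α ⟶ β) = ∀ y → x ≤ y → Truth y α → Truth y β
  Truth x (¬ᶠ α)  = ∀ y → x R₁ y → ¬ Truth y α
  Truth x (∼ α)   = ∀ y → x R₂ y → ¬ Truth y α

ValidIn : Pred N̂Frame 0ℓ → Formula → Set₁
ValidIn C α = ∀ 𝓕 → C 𝓕 → ∀ (v : Valuation 𝓕) (x : N̂Frame.X 𝓕) → Truth 𝓕 v x α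

𝔉₁ 𝔉₁′ : Pred N̂Frame 0ℓ
𝔉₁  = U
𝔉₁′ = IsN̂′Frame

{-# OPTIONS --safe #-}

-- In ILM the connective ∼ is governed by the constant f = ∼ ⊤: (A11) makes f
-- regular (¬ ¬ f → f) and ∼ α equivalent to α → f.  Conversely, for any upset D of
-- a poset, "x and y have a common upper bound (in D)" defines relations R₁ (R₂)
-- of an N̂-frame.  A finite canonical model of that shape, whose worlds
-- are sets of subformulas and D is the set of worlds containing ¬ f, proves (i).
-- Everything is constructive: worlds are found by a terminating search which
-- returns a derivation whenever there is no world to be found.
--
-- For (ii), ILM-∨ proves f ∨ ¬ f.  If f holds, restrict the canonical model
-- to worlds containing f: then R₂ is empty and the frame is an N̂′-frame.  If
-- ¬ f holds, then ∼ is ¬ and the excluded middle is available, so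
-- validity on the one-point frame suffices, by Kalmár's argument.
module Submission where

open import Data.Bool using (Bool; true; false; T)
open import Data.Empty using (⊥; ⊥-elim-irr)
import Data.Fin.Subset as Subset
open import Data.Fin.Subset using (Subset; _⊆_; _⊂_; _⊃_; ⁅_⁆)
open import Data.Fin.Subset.Induction using (⊃-wellFounded)
open import Data.Fin.Subset.Properties
  using (⊆-antisym; x∈⁅x⁆; x∈⁅y⁆⇒x≡y; p⊆p∪q; q⊆p∪q; x∈p∪q⁻; ∉⊥)
  renaming (_∈?_ to _∈ˢ?_)
open import Data.Fin.Properties using (any?)
open import Data.List using (List; []; _∷_; _++_; length; lookup; allFin)
open import Data.List.Membership.Propositional using (_∈_)
open import Data.List.Membership.Propositional.Properties using (∈-++⁺ˡ; ∈-++⁺ʳ; ∈-++⁻; ∈-allFin; ∈-lookup)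
import Data.List.Membership.DecPropositional as DecMembership
open import Data.List.Relation.Unary.All as All using (All; []; _∷_)
open import Data.List.Relation.Unary.Any as Any using (here; there; index)
open import Data.List.Relation.Unary.Any.Properties using (lookup-index)
open import Data.Maybe as Maybe using (Maybe; just; nothing; zipWith)
open import Data.Nat using (ℕ)
import Data.Nat as ℕ
open import Data.Product using (∃; _×_; _,_; proj₁; proj₂)
open import Data.Sum as Sum using (_⊎_; inj₁; inj₂; [_,_]′)
open import Data.Unit using (⊤; tt)
import Data.Unit.Properties as ⊤
open import Function using (_∘_; id)
open import Induction.WellFounded using (Acc; acc)
open import Level using (0ℓ)
open import Relation.Binary using (Rel; IsPartialOrder; DecidableEquality)
open import Relation.Binary.PropositionalEquality
  using (_≡_; refl; sym; trans; cong; cong₂; subst; isEquivalence; ≡-≟-identity)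
open import Relation.Nullary using (¬_; Dec; yes; no; contradiction)
open import Relation.Nullary.Decidable using (dec⇒maybe; _×-dec_; _⊎-dec_; ¬?; decidable-stable)
open import Relation.Unary using (Pred; U; ∅; _∪_; ｛_｝) renaming (_⊆_ to _⊑_)

open import Defs

-- Decidable equality of formulas

-- A partial test that answers on the diagonal avoids the quadratic case split.
_≟?_ : (α β : Formula) → Maybe (α ≡ β)
var p   ≟? var q   = Maybe.map (cong var) (dec⇒maybe (p ℕ.≟ q))
⊤ᶠ      ≟? ⊤ᶠ      = just refl
⊥ᶠ      ≟? ⊥ᶠ      = just refl
(α ∧ β) ≟? (γ ∧ δ) = zipWith (cong₂ _∧_) (α ≟? γ) (β ≟? δ)
(α ∨ β) ≟? (γ ∨ δ) = zipWith (cong₂ _∨_) (α ≟? γ) (β ≟? δ)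
(α ⟶ β) ≟? (γ ⟶ δ) = zipWith (cong₂ _⟶_) (α ≟? γ) (β ≟? δ)
(¬ᶠ α)  ≟? (¬ᶠ β)  = Maybe.map (cong ¬ᶠ_) (α ≟? β)
(∼ α)   ≟? (∼ β)   = Maybe.map (cong ∼_) (α ≟? β)
_       ≟? _       = nothing

≟?-refl : ∀ α → (α ≟? α) ≡ just refl
≟?-refl (var p) rewrite ≡-≟-identity ℕ._≟_ {p} refl = refl
≟?-refl ⊤ᶠ = refl
≟?-refl ⊥ᶠ = refl
≟?-refl (α ∧ β) rewrite ≟?-refl α | ≟?-refl β = refl
≟?-refl (α ∨ β) rewrite ≟?-refl α | ≟?-refl β = refl
≟?-refl (α ⟶ β) rewrite ≟?-refl α | ≟?-refl β = refl
≟?-refl (¬ᶠ α) rewrite ≟?-refl α = refl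
≟?-refl (∼ α) rewrite ≟?-refl α = refl

_≟_ : DecidableEquality Formula
α ≟ β with α ≟? β in eq
... | just α≡β = yes α≡β
... | nothing  = no λ { refl → contradiction (trans (sym eq) (≟?-refl α)) λ () }

open DecMembership _≟_ using (_∈?_)

-- Subformulas

children : Formula → List Formula
children (α ∧ β) = α ∷ β ∷ []
children (α ∨ β) = α ∷ β ∷ []
children (α ⟶ β) = α ∷ β ∷ []
children (¬ᶠ α)  = α ∷ []
children (∼ α)   = α ∷ []
children _       = []

SubformulaClosed : List Formula → Set
SubformulaClosed Φ = ∀ {β} → β ∈ Φ → All (_∈ Φ) (children β)

∷-closed : ∀ {α Φ} → All (_∈ Φ) (children α) → SubformulaClosed Φ → SubformulaClosed (α ∷ Φ)
∷-closed c⊆Φ closed (here refl) = All.map there c⊆Φ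
∷-closed c⊆Φ closed (there β∈Φ) = All.map there (closed β∈Φ)

++-closed : ∀ {Φ Ψ} → SubformulaClosed Φ → SubformulaClosed Ψ → SubformulaClosed (Φ ++ Ψ)
++-closed {Φ} cΦ cΨ β∈ with ∈-++⁻ Φ β∈
... | inj₁ β∈Φ = All.map ∈-++⁺ˡ (cΦ β∈Φ)
... | inj₂ β∈Ψ = All.map (∈-++⁺ʳ Φ) (cΨ β∈Ψ)

subformulas properSubformulas : Formula → List Formula
subformulas α = α ∷ properSubformulas α

properSubformulas (α ∧ β) = subformulas α ++ subformulas β
properSubformulas (α ∨ β) = subformulas α ++ subformulas β
properSubformulas (α ⟶ β) = subformulas α ++ subformulas β
properSubformulas (¬ᶠ α)  = subformulas α
properSubformulas (∼ α)   = subformulas α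
properSubformulas _       = []

both-∈ : ∀ α β → All (_∈ subformulas α ++ subformulas β) (α ∷ β ∷ [])
both-∈ α β = here refl ∷ ∈-++⁺ʳ (subformulas α) (here refl) ∷ []

subformulas-closed : ∀ α → SubformulaClosed (subformulas α)
subformulas-closed (var p) (here refl) = []
subformulas-closed ⊤ᶠ      (here refl) = []
subformulas-closed ⊥ᶠ      (here refl) = []
subformulas-closed (α ∧ β) =
  ∷-closed (both-∈ α β) (++-closed (subformulas-closed α) (subformulas-closed β))
subformulas-closed (α ∨ β) =
  ∷-closed (both-∈ α β) (++-closed (subformulas-closed α) (subformulas-closed β))
subformulas-closed (α ⟶ β) =
  ∷-closed (both-∈ α β) (++-closed (subformulas-closed α) (subformulas-closed β))
subformulas-closed (¬ᶠ α)  = ∷-closed (here refl ∷ []) (subformulas-closed α)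
subformulas-closed (∼ α)   = ∷-closed (here refl ∷ []) (subformulas-closed α)

-- Natural deduction

infix 4 _⊢_
infixl 5 _▸_

-- Hypotheses count as extra axioms over `ILM`, so `Γ` may also contain all of `ILM-∨`, and one
-- deduction theorem serves both logics.
_⊢_ : Pred Formula 0ℓ → Pred Formula 0ℓ
Γ ⊢ α = ⊢[ ILM ∪ Γ ] α

_▸_ : Pred Formula 0ℓ → Formula → Pred Formula 0ℓ
Γ ▸ α = Γ ∪ ｛ α ｝

map-axioms : ∀ {Ax Bx} → Ax ⊑ Bx → ∀ {α} → ⊢[ Ax ] α → ⊢[ Bx ] α
map-axioms f (axiom a) = axiom (f a)
map-axioms f (mp d e)  = mp (map-axioms f d) (map-axioms f e)

module _ {Γ : Pred Formula 0ℓ} where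

  ax : ∀ {α} → ILM α → Γ ⊢ α
  ax = axiom ∘ inj₁

  hyp : ∀ {α} → Γ α → Γ ⊢ α
  hyp = axiom ∘ inj₂

  last : ∀ {α} → Γ ▸ α ⊢ α
  last = axiom (inj₂ (inj₂ refl))

  weaken : ∀ {Δ} → Γ ⊑ Δ → ∀ {α} → Γ ⊢ α → Δ ⊢ α
  weaken Γ⊆Δ = map-axioms (Sum.map₂ Γ⊆Δ)

  const⟶ : ∀ {α β} → Γ ⊢ α → Γ ⊢ β ⟶ α
  const⟶ = mp (ax (A1 _ _))

  ⟶I : ∀ {α β} → Γ ▸ β ⊢ α → Γ ⊢ β ⟶ α
  ⟶I (axiom (inj₁ a))        = const⟶ (ax a)
  ⟶I (axiom (inj₂ (inj₁ h))) = const⟶ (hyp h)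
  ⟶I {α} (axiom (inj₂ (inj₂ refl))) =
    mp (mp (ax (A2 α (α ⟶ α) α)) (ax (A1 _ _))) (ax (A1 _ _))
  ⟶I (mp d e) = mp (mp (ax (A2 _ _ _)) (⟶I d)) (⟶I e)

  ∧I : ∀ {α β} → Γ ⊢ α → Γ ⊢ β → Γ ⊢ α ∧ β
  ∧I {α} d e = mp (mp (mp (ax (A6 α _ _)) (⟶I last)) (const⟶ e)) d

  ∧E₁ : ∀ {α β} → Γ ⊢ α ∧ β → Γ ⊢ α
  ∧E₁ = mp (ax (A5ˡ _ _))

  ∧E₂ : ∀ {α β} → Γ ⊢ α ∧ β → Γ ⊢ β
  ∧E₂ = mp (ax (A5ʳ _ _))

  ∨I₁ : ∀ {α β} → Γ ⊢ α → Γ ⊢ α ∨ β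
  ∨I₁ = mp (ax (A3ˡ _ _))

  ∨I₂ : ∀ {α β} → Γ ⊢ β → Γ ⊢ α ∨ β
  ∨I₂ = mp (ax (A3ʳ _ _))

  ∨E : ∀ {α β γ} → Γ ⊢ α ∨ β → Γ ▸ α ⊢ γ → Γ ▸ β ⊢ γ → Γ ⊢ γ
  ∨E d e₁ e₂ = mp (mp (mp (ax (A4 _ _ _)) (⟶I e₁)) (⟶I e₂)) d

  ⊤I : Γ ⊢ ⊤ᶠ
  ⊤I = mp (ax (A7 (⊥ᶠ ⟶ ⊥ᶠ))) (ax (A8 _))

  ⊥E : ∀ {α} → Γ ⊢ ⊥ᶠ → Γ ⊢ α
  ⊥E = mp (ax (A8 _))

  ¬I : ∀ {α β} → Γ ▸ α ⊢ β → Γ ▸ α ⊢ ¬ᶠ β → Γ ⊢ ¬ᶠ α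
  ¬I d e = mp (mp (ax (A9 _ _)) (⟶I d)) (⟶I e)

  ¬E : ∀ {α β} → Γ ⊢ ¬ᶠ α → Γ ⊢ α → Γ ⊢ β
  ¬E d e = mp (mp (ax (A10 _ _)) d) e

  ∼I : ∀ {α} → Γ ▸ α ⊢ ¬ᶠ ¬ᶠ ∼ ⊤ᶠ → Γ ⊢ ∼ α
  ∼I d = mp (∧E₂ (ax (A11 _))) (⟶I d)

  ∼E : ∀ {α} → Γ ⊢ ∼ α → Γ ⊢ α → Γ ⊢ ¬ᶠ ¬ᶠ ∼ ⊤ᶠ
  ∼E d = mp (mp (∧E₁ (ax (A11 _))) d)

from-∅ : ∀ {α} → ∅ ⊢ α → ⊢[ ILM ] α
from-∅ = map-axioms [ id , (λ ()) ]′

weaken₁ : ∀ {Γ α β} → Γ ⊢ α → Γ ▸ β ⊢ α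
weaken₁ = weaken inj₁

-- Frames and truth

module _ (𝓕 : N̂Frame) (v : Valuation 𝓕) where
  open N̂Frame 𝓕
  open Valuation v
  private
    module H₁ = IsStrictlyCondensedHFrame isHFrame₁
    module J₁ = IsStrictlyCondensedJFrame H₁.isStrictlyCondensedJFrame
    module J₂ = IsStrictlyCondensedJFrame isJFrame₂
    module ≤₁ = IsPartialOrder J₁.isPartialOrder

  Truth-mono : ∀ α {x y} → x ≤ y → Truth 𝓕 v x α → Truth 𝓕 v y α
  Truth-mono (var p) x≤y t           = upset p x≤y t
  Truth-mono ⊤ᶠ      x≤y t           = t
  Truth-mono (α ∧ β) x≤y (t , u)     = Truth-mono α x≤y t , Truth-mono β x≤y u
  Truth-mono (α ∨ β) x≤y             = Sum.map (Truth-mono α x≤y) (Truth-mono β x≤y)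
  Truth-mono (α ⟶ β) x≤y t z y≤z     = t z (≤₁.trans x≤y y≤z)
  Truth-mono (¬ᶠ α)  x≤y t z yRz     = t z (J₁.condensed x≤y yRz ≤₁.refl)
  Truth-mono (∼ α)   x≤y t z yRz     = t z (J₂.condensed x≤y yRz ≤₁.refl)

module _ {X : Set} {_≤_ : Rel X 0ℓ} (isPO : IsPartialOrder _≡_ _≤_) where
  private module ≤ = IsPartialOrder isPO

  BoundedIn : Pred X 0ℓ → Rel X 0ℓ
  BoundedIn D x y = ∃ λ z → x ≤ z × y ≤ z × D z

  BoundedIn-isJFrame : ∀ D → IsStrictlyCondensedJFrame _≤_ (BoundedIn D)
  BoundedIn-isJFrame D = record
    { isPartialOrder = isPO
    ; condensed = λ { x≤x′ (z , x′≤z , y′≤z , Dz) y≤y′ →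
                      z , ≤.trans x≤x′ x′≤z , ≤.trans y≤y′ y′≤z , Dz }
    ; symmetric = λ { (z , x≤z , y≤z , Dz) → z , y≤z , x≤z , Dz }
    ; strict    = λ { (z , x≤z , y≤z , Dz) → z , x≤z , y≤z , z , x≤z , ≤.refl , Dz }
    }

  upsetFrame : (D : Pred X 0ℓ) → (∀ {x y} → x ≤ y → D x → D y) → N̂Frame
  upsetFrame D D-upset = record
    { X = X
    ; _≤_ = _≤_
    ; _R₁_ = BoundedIn U
    ; _R₂_ = BoundedIn D
    ; isHFrame₁ = record
      { isStrictlyCondensedJFrame = BoundedIn-isJFrame U
      ; reflexive = λ {x} → x , ≤.refl , ≤.refl , tt
      }
    ; isJFrame₂ = BoundedIn-isJFrame D
    -- The bound `w` of `x` in `D` is itself `R₁`-related to `x`. The point `z` that `h` supplies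
    -- shares a bound `u` with `w`; as `D` is an upset, `u` lies in `D`, so `z` is not isolated.
    ; R₁-R₂ = λ { x h (_ , w , x≤w , _ , Dw) →
        let z , (u , w≤u , z≤u , _) , z-isolated = h w (w , x≤w , ≤.refl , tt)
        in z-isolated (u , u , z≤u , ≤.refl , D-upset w≤u Dw) }
    }

-- The canonical model

module Canonical
  (Φ : List Formula) (closed : SubformulaClosed Φ) (¬∼⊤∈Φ : ¬ᶠ ∼ ⊤ᶠ ∈ Φ) where

  infix 4 _∈ᶠ_ _∉ᶠ_ _∈ᶠ?_

  -- Sets of formulas are sets of positions in `Φ`, for which inclusion is antisymmetric up to `_≡_`
  -- and strict growth is well-founded. A formula listed twice belongs as soon as one of its
  -- positions does.
  _∈ᶠ_ _∉ᶠ_ : Formula → Subset (length Φ) → Set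
  α ∈ᶠ Γ = ∃ λ i → i Subset.∈ Γ × lookup Φ i ≡ α
  α ∉ᶠ Γ = ¬ α ∈ᶠ Γ

  _∈ᶠ?_ : ∀ α Γ → Dec (α ∈ᶠ Γ)
  α ∈ᶠ? Γ = any? λ i → (i ∈ˢ? Γ) ×-dec (lookup Φ i ≟ α)

  ⟪_⟫ : Subset (length Φ) → Pred Formula 0ℓ
  ⟪ Γ ⟫ α = α ∈ᶠ Γ

  ⟪⟫-mono : ∀ {Γ Δ} → Γ ⊆ Δ → ⟪ Γ ⟫ ⊑ ⟪ Δ ⟫
  ⟪⟫-mono Γ⊆Δ (i , i∈Γ , eq) = i , Γ⊆Δ i∈Γ , eq

  insert : ∀ {α} → α ∈ Φ → Subset (length Φ) → Subset (length Φ)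
  insert α∈Φ Γ = Γ Subset.∪ ⁅ index α∈Φ ⁆

  module _ {α} (α∈Φ : α ∈ Φ) {Γ : Subset (length Φ)} where

    insert-⊇ : Γ ⊆ insert α∈Φ Γ
    insert-⊇ = p⊆p∪q _

    insert-∈ : α ∈ᶠ insert α∈Φ Γ
    insert-∈ = index α∈Φ , q⊆p∪q Γ _ (x∈⁅x⁆ _) , sym (lookup-index α∈Φ)

    insert-⊃ : α ∉ᶠ Γ → insert α∈Φ Γ ⊃ Γ
    insert-⊃ α∉Γ = insert-⊇ , index α∈Φ , q⊆p∪q Γ _ (x∈⁅x⁆ _) ,
                   λ i∈Γ → α∉Γ (_ , i∈Γ , sym (lookup-index α∈Φ))

    insert-⊑ : ⟪ insert α∈Φ Γ ⟫ ⊑ ⟪ Γ ⟫ ▸ α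
    insert-⊑ (i , i∈ , refl) with x∈p∪q⁻ Γ _ i∈
    ... | inj₁ i∈Γ = inj₁ (i , i∈Γ , refl)
    ... | inj₂ i∈⁅⁆ rewrite x∈⁅y⁆⇒x≡y _ i∈⁅⁆ = inj₂ (lookup-index α∈Φ)

  -- The failure of α at a world, read off membership of its subformulas; for
  -- ⟶, ¬ᶠ and ∼ this is the failure witnessed by the world itself.
  Counter : Subset (length Φ) → Formula → Set
  Counter Γ (var p) = var p ∉ᶠ Γ
  Counter Γ ⊤ᶠ      = ⊥
  Counter Γ ⊥ᶠ      = ⊤
  Counter Γ (α ∧ β) = α ∉ᶠ Γ ⊎ β ∉ᶠ Γ
  Counter Γ (α ∨ β) = α ∉ᶠ Γ × β ∉ᶠ Γ
  Counter Γ (α ⟶ β) = α ∈ᶠ Γ × β ∉ᶠ Γ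
  Counter Γ (¬ᶠ α)  = α ∈ᶠ Γ
  Counter Γ (∼ α)   = α ∈ᶠ Γ × ¬ᶠ ∼ ⊤ᶠ ∈ᶠ Γ

  Counter? : ∀ Γ α → Dec (Counter Γ α)
  Counter? Γ (var p) = ¬? (var p ∈ᶠ? Γ)
  Counter? Γ ⊤ᶠ      = no λ ()
  Counter? Γ ⊥ᶠ      = yes tt
  Counter? Γ (α ∧ β) = ¬? (α ∈ᶠ? Γ) ⊎-dec ¬? (β ∈ᶠ? Γ)
  Counter? Γ (α ∨ β) = ¬? (α ∈ᶠ? Γ) ×-dec ¬? (β ∈ᶠ? Γ)
  Counter? Γ (α ⟶ β) = (α ∈ᶠ? Γ) ×-dec ¬? (β ∈ᶠ? Γ)
  Counter? Γ (¬ᶠ α)  = α ∈ᶠ? Γ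
  Counter? Γ (∼ α)   = (α ∈ᶠ? Γ) ×-dec (¬ᶠ ∼ ⊤ᶠ ∈ᶠ? Γ)

  data World (Γ : Subset (length Φ)) : Set

  -- A world stores the witnesses that the truth lemma needs. Failure at the world itself is a
  -- separate alternative because the definition is inductive: a world under construction cannot
  -- cite itself.
  record Saturated (Γ : Subset (length Φ)) (α : Formula) : Set where
    inductive
    constructor saturated
    field
      ∈⇒¬counter : α ∈ᶠ Γ → ¬ Counter Γ α
      ∉⇒counter  : α ∉ᶠ Γ → Counter Γ α ⊎ (∃ λ Δ → Γ ⊆ Δ × World Δ × Counter Δ α)

  data World Γ where
    world : (∀ {α} → α ∈ Φ → Saturated Γ α) → World Γ

  ∈ᶠ⇒∈ : ∀ {α Γ} → α ∈ᶠ Γ → α ∈ Φ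
  ∈ᶠ⇒∈ (i , _ , refl) = ∈-lookup i

  World⇒¬Counter : ∀ {Γ α} → World Γ → α ∈ᶠ Γ → ¬ Counter Γ α
  World⇒¬Counter (world s) α∈Γ = Saturated.∈⇒¬counter (s (∈ᶠ⇒∈ α∈Γ)) α∈Γ

  -- The search for worlds

  Decided : Subset (length Φ) → Set
  Decided Γ = ∀ {α} → α ∈ Φ → ⟪ Γ ⟫ ⊢ α ⊎ (∃ λ Δ → Γ ⊆ Δ × World Δ × α ∉ᶠ Δ)

  -- Obstacles to being a world, each of which lets the search stop or pass to larger sets. With
  -- equal disjuncts, `split` also covers a derivable nonmember, as in `missing`.
  data Defect (Γ : Subset (length Φ)) : Set where
    inconsistent : ⟪ Γ ⟫ ⊢ ⊥ᶠ → Defect Γ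
    split        : ∀ {α β} → α ∈ Φ → β ∈ Φ → α ∉ᶠ Γ → β ∉ᶠ Γ → ⟪ Γ ⟫ ⊢ α ∨ β → Defect Γ

  missing : ∀ {Γ α} → α ∈ Φ → α ∉ᶠ Γ → ⟪ Γ ⟫ ⊢ α → Defect Γ
  missing α∈Φ α∉Γ d = split α∈Φ α∈Φ α∉Γ α∉Γ (∨I₁ d)

  module _ {Γ : Subset (length Φ)} (rec : ∀ {Δ} → Δ ⊃ Γ → Decided Δ) where

    decide-insert : ∀ {α β} → α ∈ Φ → α ∉ᶠ Γ → β ∈ Φ →
      ⟪ Γ ⟫ ▸ α ⊢ β ⊎ (∃ λ Δ → Γ ⊆ Δ × World Δ × α ∈ᶠ Δ × β ∉ᶠ Δ)
    decide-insert α∈Φ α∉Γ β∈Φ with rec (insert-⊃ α∈Φ α∉Γ) β∈Φ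
    ... | inj₁ d = inj₁ (weaken (insert-⊑ α∈Φ) d)
    ... | inj₂ (Δ , Γα⊆Δ , w , β∉Δ) =
      inj₂ (Δ , Γα⊆Δ ∘ insert-⊇ α∈Φ , w , ⟪⟫-mono Γα⊆Δ (insert-∈ α∈Φ) , β∉Δ)

    -- Both disjuncts of a `split` are nonmembers, so inserting either enlarges the set strictly. A
    -- world avoiding the goal above one of these sets is also above `Γ`; failing that, both derive
    -- the goal and `∨E` applies.
    defect⇒decided : Defect Γ → Decided Γ
    defect⇒decided (inconsistent d) γ∈Φ = inj₁ (⊥E d)
    defect⇒decided (split α∈Φ β∈Φ α∉Γ β∉Γ d) γ∈Φ
      with decide-insert α∈Φ α∉Γ γ∈Φ | decide-insert β∈Φ β∉Γ γ∈Φ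
    ... | inj₂ (Δ , Γ⊆Δ , w , _ , γ∉Δ) | _ = inj₂ (Δ , Γ⊆Δ , w , γ∉Δ)
    ... | inj₁ _ | inj₂ (Δ , Γ⊆Δ , w , _ , γ∉Δ) = inj₂ (Δ , Γ⊆Δ , w , γ∉Δ)
    ... | inj₁ e₁ | inj₁ e₂ = inj₁ (∨E d e₁ e₂)

    -- The elimination rule of the connective produces the defect.
    counter⇒defect : ∀ α → α ∈ᶠ Γ → Counter Γ α → Defect Γ
    counter⇒defect (var p) α∈Γ c = contradiction α∈Γ c
    counter⇒defect ⊥ᶠ      α∈Γ c = inconsistent (hyp α∈Γ)
    counter⇒defect (α ∧ β) α∈Γ c with closed (∈ᶠ⇒∈ α∈Γ) | c
    ... | α∈Φ ∷ _ ∷ [] | inj₁ α∉Γ = missing α∈Φ α∉Γ (∧E₁ (hyp α∈Γ))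
    ... | _ ∷ β∈Φ ∷ [] | inj₂ β∉Γ = missing β∈Φ β∉Γ (∧E₂ (hyp α∈Γ))
    counter⇒defect (α ∨ β) α∈Γ (α∉Γ , β∉Γ) with closed (∈ᶠ⇒∈ α∈Γ)
    ... | α∈Φ ∷ β∈Φ ∷ [] = split α∈Φ β∈Φ α∉Γ β∉Γ (hyp α∈Γ)
    counter⇒defect (α ⟶ β) α∈Γ (a , β∉Γ) with closed (∈ᶠ⇒∈ α∈Γ)
    ... | _ ∷ β∈Φ ∷ [] = missing β∈Φ β∉Γ (mp (hyp α∈Γ) (hyp a))
    counter⇒defect (¬ᶠ α)  α∈Γ a = inconsistent (¬E (hyp α∈Γ) (hyp a))
    counter⇒defect (∼ α)   α∈Γ (a , n) = inconsistent (¬E (∼E (hyp α∈Γ) (hyp a)) (hyp n))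

    -- Where a larger set has to be consulted, a world found above it is the counterexample, while a
    -- derivation from it becomes, by the introduction rule, a derivation from `Γ` of a nonmember.
    find-counter : ∀ α → α ∈ Φ → α ∉ᶠ Γ → ¬ Counter Γ α →
      (∃ λ Δ → Γ ⊆ Δ × World Δ × Counter Δ α) ⊎ Defect Γ
    find-counter (var p) α∈Φ α∉Γ ¬c = contradiction α∉Γ ¬c
    find-counter ⊤ᶠ α∈Φ α∉Γ ¬c = inj₂ (missing α∈Φ α∉Γ ⊤I)
    find-counter ⊥ᶠ α∈Φ α∉Γ ¬c = contradiction tt ¬c
    find-counter (α ∧ β) α∈Φ α∉Γ ¬c with α ∈ᶠ? Γ | β ∈ᶠ? Γ
    ... | yes a | yes b = inj₂ (missing α∈Φ α∉Γ (∧I (hyp a) (hyp b)))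
    ... | no ¬a | _     = contradiction (inj₁ ¬a) ¬c
    ... | yes _ | no ¬b = contradiction (inj₂ ¬b) ¬c
    find-counter (α ∨ β) α∈Φ α∉Γ ¬c with α ∈ᶠ? Γ | β ∈ᶠ? Γ
    ... | yes a | _     = inj₂ (missing α∈Φ α∉Γ (∨I₁ (hyp a)))
    ... | no _  | yes b = inj₂ (missing α∈Φ α∉Γ (∨I₂ (hyp b)))
    ... | no ¬a | no ¬b = contradiction (¬a , ¬b) ¬c
    find-counter (α ⟶ β) αβ∈Φ αβ∉Γ ¬c with closed αβ∈Φ | α ∈ᶠ? Γ
    ... | _ ∷ _ ∷ [] | yes a =
      inj₂ (missing αβ∈Φ αβ∉Γ
        (const⟶ (hyp (decidable-stable (β ∈ᶠ? Γ) (λ ¬b → ¬c (a , ¬b))))))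
    ... | α∈Φ ∷ β∈Φ ∷ [] | no ¬a =
      Sum.swap (Sum.map₁ (missing αβ∈Φ αβ∉Γ ∘ ⟶I) (decide-insert α∈Φ ¬a β∈Φ))
    find-counter (¬ᶠ α) ¬α∈Φ ¬α∉Γ α∉Γ with closed ¬α∈Φ
    -- `¬ᶠ α` itself is taken as the goal in place of absurdity, since the search accepts only goals
    -- in `Φ` and `⊥ᶠ` need not be there.
    ... | α∈Φ ∷ [] with decide-insert α∈Φ α∉Γ ¬α∈Φ
    ... | inj₁ d = inj₂ (missing ¬α∈Φ ¬α∉Γ (¬I last d))
    ... | inj₂ (Δ , Γ⊆Δ , w , a , _) = inj₁ (Δ , Γ⊆Δ , w , a)
    find-counter (∼ α) ∼α∈Φ ∼α∉Γ ¬c with closed ∼α∈Φ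
    ... | α∈Φ ∷ [] = Sum.swap (Sum.map derive extract (rec Γ⊂Γ′ ∼α∈Φ))
      where
      Γ′ = insert ¬∼⊤∈Φ (insert α∈Φ Γ)

      Γ⊆Γ′ : Γ ⊆ Γ′
      Γ⊆Γ′ = insert-⊇ ¬∼⊤∈Φ ∘ insert-⊇ α∈Φ {Γ}

      α∈Γ′ : α ∈ᶠ Γ′
      α∈Γ′ = ⟪⟫-mono (insert-⊇ ¬∼⊤∈Φ) (insert-∈ α∈Φ)

      Γ⊂Γ′ : Γ ⊂ Γ′
      Γ⊂Γ′ with α ∈ᶠ? Γ
      ... | no α∉Γ with insert-⊃ α∈Φ α∉Γ
      ...   | _ , i , i∈ , i∉ = Γ⊆Γ′ , i , insert-⊇ ¬∼⊤∈Φ i∈ , i∉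
      -- With `α` a member and no counter to `∼ α` at `Γ`, the formula `¬ᶠ ∼ ⊤ᶠ` is a nonmember, and
      -- its position makes the inclusion strict.
      Γ⊂Γ′ | yes a with insert-⊃ ¬∼⊤∈Φ {Γ} (λ n → ¬c (a , n))
      ...   | _ , i , i∈ , i∉ with x∈p∪q⁻ Γ _ i∈
      ...     | inj₁ i∈Γ  = contradiction i∈Γ i∉
      ...     | inj₂ i∈⁅⁆ = Γ⊆Γ′ , i , q⊆p∪q (insert α∈Φ Γ) _ i∈⁅⁆ , i∉

      derive : ⟪ Γ′ ⟫ ⊢ ∼ α → Defect Γ
      -- Given `α` and `¬ᶠ ∼ ⊤ᶠ`, the derived `∼ α` yields `¬ᶠ ¬ᶠ ∼ ⊤ᶠ`; so `α` alone refutes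
      -- `¬ᶠ ∼ ⊤ᶠ`, which is what `∼I` asks for.
      derive d = missing ∼α∈Φ ∼α∉Γ (∼I (¬I last (∼E d′ (weaken₁ last))))
        where
        d′ : ⟪ Γ ⟫ ▸ α ▸ ¬ᶠ ∼ ⊤ᶠ ⊢ ∼ α
        d′ = weaken ([ inj₁ ∘ insert-⊑ α∈Φ , inj₂ ]′ ∘ insert-⊑ ¬∼⊤∈Φ) d

      extract : (∃ λ Δ → Γ′ ⊆ Δ × World Δ × ∼ α ∉ᶠ Δ) →
                ∃ λ Δ → Γ ⊆ Δ × World Δ × α ∈ᶠ Δ × ¬ᶠ ∼ ⊤ᶠ ∈ᶠ Δ
      extract (Δ , Γ′⊆Δ , w , _) =
        Δ , Γ′⊆Δ ∘ Γ⊆Γ′ , w , ⟪⟫-mono Γ′⊆Δ α∈Γ′ , ⟪⟫-mono Γ′⊆Δ (insert-∈ ¬∼⊤∈Φ)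

    saturated⊎defect : ∀ {α} → α ∈ Φ → Saturated Γ α ⊎ Defect Γ
    saturated⊎defect {α} α∈Φ with α ∈ᶠ? Γ | Counter? Γ α
    ... | yes α∈Γ | yes c = inj₂ (counter⇒defect α α∈Γ c)
    ... | yes α∈Γ | no ¬c = inj₁ (saturated (λ _ → ¬c) (contradiction α∈Γ))
    ... | no α∉Γ  | yes c = inj₁ (saturated (λ α∈Γ → contradiction α∈Γ α∉Γ) (λ _ → inj₁ c))
    ... | no α∉Γ  | no ¬c =
      Sum.map₁ (λ x → saturated (λ _ → ¬c) (λ _ → inj₂ x)) (find-counter α α∈Φ α∉Γ ¬c)

    world⊎defect : World Γ ⊎ Defect Γ
    world⊎defect with All.decide (λ i → saturated⊎defect (∈-lookup i)) (allFin (length Φ))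
    ... | inj₁ all = inj₁ (world λ α∈Φ →
      subst (Saturated Γ) (sym (lookup-index α∈Φ)) (All.lookup all (∈-allFin (index α∈Φ))))
    ... | inj₂ any = inj₂ (proj₂ (Any.satisfied any))

    decided : Decided Γ
    decided {α} α∈Φ with world⊎defect | α ∈ᶠ? Γ
    ... | inj₂ δ | _       = defect⇒decided δ α∈Φ
    ... | inj₁ _ | yes α∈Γ = inj₁ (hyp α∈Γ)
    ... | inj₁ w | no α∉Γ  = inj₂ (Γ , id , w , α∉Γ)

  -- Lindenbaum's lemma in constructive form; the recursion ends because sets of positions can grow
  -- strictly only finitely often.
  search : ∀ Γ → Decided Γ
  search Γ = go (⊃-wellFounded Γ)
    where
    go : ∀ {Γ} → Acc _⊃_ Γ → Decided Γ
    go (acc rs) = decided λ Δ⊃Γ → go (rs Δ⊃Γ)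

  -- Every world above one containing `χ` contains `χ` too, so refuting a formula at a larger world
  -- never leaves the model. `χ` will be `⊤ᶠ` for (i) and `∼ ⊤ᶠ` for the first case of (ii).
  module Model (χ : Formula) where

    -- Irrelevance of the two proofs makes inclusion antisymmetric for _≡_; they
    -- are only used to refute, or to establish decidable propositions.
    record Point : Set where
      constructor point
      field
        set      : Subset (length Φ)
        .χ∈set   : χ ∈ᶠ set
        .isWorld : World set
    open Point

    _≤ᵖ_ : Rel Point 0ℓ
    x ≤ᵖ y = set x ⊆ set y

    ≤ᵖ-antisym : ∀ {x y} → x ≤ᵖ y → y ≤ᵖ x → x ≡ y
    ≤ᵖ-antisym {point Γ _ _} {point Δ _ _} Γ⊆Δ Δ⊆Γ with ⊆-antisym {i = Γ} {Δ} Γ⊆Δ Δ⊆Γ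
    ... | refl = refl

    ≤ᵖ-isPartialOrder : IsPartialOrder _≡_ _≤ᵖ_
    ≤ᵖ-isPartialOrder = record
      { isPreorder = record
        { isEquivalence = isEquivalence
        ; reflexive = λ { refl → id }
        ; trans = λ x≤y y≤z → y≤z ∘ x≤y
        }
      ; antisym = ≤ᵖ-antisym
      }

    frame : N̂Frame
    frame = upsetFrame ≤ᵖ-isPartialOrder (λ x → ¬ᶠ ∼ ⊤ᶠ ∈ᶠ set x) λ x≤y → ⟪⟫-mono x≤y

    valuation : Valuation frame
    valuation = record
      { V = λ p x → var p ∈ᶠ set x
      ; upset = λ p x≤y → ⟪⟫-mono x≤y
      }

    _⊨_ : Point → Formula → Set
    _⊨_ = Truth frame valuation

    ∈⇒¬Counter : ∀ x {α} → α ∈ᶠ set x → ¬ Counter (set x) α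
    ∈⇒¬Counter (point Γ _ w) α∈Γ c = ⊥-elim-irr (World⇒¬Counter w α∈Γ c)

    -- The world proof in a point is irrelevant, so a larger world cannot be extracted from it, only
    -- used towards `⊥`. The doubly negated form suffices because membership is decidable.
    ∉⇒¬¬Counter : ∀ x {α} → α ∈ Φ → α ∉ᶠ set x → ¬ (∀ y → x ≤ᵖ y → ¬ Counter (set y) α)
    ∉⇒¬¬Counter (point Γ χ∈Γ w) {α} α∈Φ α∉Γ k = ⊥-elim-irr (refute χ∈Γ w)
      where
      refute : χ ∈ᶠ Γ → World Γ → ⊥
      refute χ∈Γ w@(world s) with Saturated.∉⇒counter (s α∈Φ) α∉Γ
      ... | inj₁ c = k (point Γ χ∈Γ w) id c
      ... | inj₂ (Δ , Γ⊆Δ , w′ , c) = k (point Δ (⟪⟫-mono Γ⊆Δ χ∈Γ) w′) Γ⊆Δ c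

    -- The truth lemma, by simultaneous induction on `α`. For the converse direction, a nonmember
    -- cannot lack a counter at all larger points, and truth persists to them; it remains to exclude
    -- a counter at a point where the formula is true, which involves only immediate subformulas.
    truth      : ∀ α → α ∈ Φ → ∀ x → α ∈ᶠ set x → x ⊨ α
    truth⁻¹    : ∀ α → α ∈ Φ → ∀ x → x ⊨ α → α ∈ᶠ set x
    ⊨⇒¬Counter : ∀ α → α ∈ Φ → ∀ x → x ⊨ α → ¬ Counter (set x) α

    truth (var p) _ x α∈x = α∈x
    truth ⊤ᶠ _ x α∈x = tt
    truth ⊥ᶠ _ x α∈x = ∈⇒¬Counter x α∈x tt
    truth (α ∧ β) αβ∈Φ x αβ∈x with closed αβ∈Φ
    ... | α∈Φ ∷ β∈Φ ∷ [] =
      truth α α∈Φ x (decidable-stable (α ∈ᶠ? set x) (∈⇒¬Counter x αβ∈x ∘ inj₁)) ,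
      truth β β∈Φ x (decidable-stable (β ∈ᶠ? set x) (∈⇒¬Counter x αβ∈x ∘ inj₂))
    truth (α ∨ β) αβ∈Φ x αβ∈x with closed αβ∈Φ | α ∈ᶠ? set x
    ... | α∈Φ ∷ _ ∷ [] | yes α∈x = inj₁ (truth α α∈Φ x α∈x)
    ... | _ ∷ β∈Φ ∷ [] | no  α∉x = inj₂ (truth β β∈Φ x
      (decidable-stable (β ∈ᶠ? set x) λ β∉x → ∈⇒¬Counter x αβ∈x (α∉x , β∉x)))
    truth (α ⟶ β) αβ∈Φ x αβ∈x y x≤y y⊨α with closed αβ∈Φ
    ... | α∈Φ ∷ β∈Φ ∷ [] = truth β β∈Φ y
      (decidable-stable (β ∈ᶠ? set y) λ β∉y →
        ∈⇒¬Counter y (⟪⟫-mono x≤y αβ∈x) (truth⁻¹ α α∈Φ y y⊨α , β∉y))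
    truth (¬ᶠ α) ¬α∈Φ x ¬α∈x y (z , x≤z , y≤z , _) y⊨α with closed ¬α∈Φ
    ... | α∈Φ ∷ [] =
      ∈⇒¬Counter z (⟪⟫-mono x≤z ¬α∈x) (⟪⟫-mono y≤z (truth⁻¹ α α∈Φ y y⊨α))
    truth (∼ α) ∼α∈Φ x ∼α∈x y (z , x≤z , y≤z , ¬∼⊤∈z) y⊨α with closed ∼α∈Φ
    ... | α∈Φ ∷ [] =
      ∈⇒¬Counter z (⟪⟫-mono x≤z ∼α∈x) (⟪⟫-mono y≤z (truth⁻¹ α α∈Φ y y⊨α) , ¬∼⊤∈z)

    truth⁻¹ α α∈Φ x x⊨α = decidable-stable (α ∈ᶠ? set x) λ α∉x →
      ∉⇒¬¬Counter x α∈Φ α∉x λ y x≤y →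
        ⊨⇒¬Counter α α∈Φ y (Truth-mono frame valuation α {x} {y} x≤y x⊨α)

    ⊨⇒¬Counter (var p) _ x α∈x α∉x = α∉x α∈x
    ⊨⇒¬Counter (α ∧ β) αβ∈Φ x (x⊨α , x⊨β) c with closed αβ∈Φ
    ... | α∈Φ ∷ β∈Φ ∷ [] =
      [ (λ α∉x → α∉x (truth⁻¹ α α∈Φ x x⊨α)) , (λ β∉x → β∉x (truth⁻¹ β β∈Φ x x⊨β)) ]′ c
    ⊨⇒¬Counter (α ∨ β) αβ∈Φ x x⊨αβ (α∉x , β∉x) with closed αβ∈Φ
    ... | α∈Φ ∷ β∈Φ ∷ [] = [ α∉x ∘ truth⁻¹ α α∈Φ x , β∉x ∘ truth⁻¹ β β∈Φ x ]′ x⊨αβ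
    ⊨⇒¬Counter (α ⟶ β) αβ∈Φ x x⊨αβ (α∈x , β∉x) with closed αβ∈Φ
    ... | α∈Φ ∷ β∈Φ ∷ [] = β∉x (truth⁻¹ β β∈Φ x (x⊨αβ x id (truth α α∈Φ x α∈x)))
    ⊨⇒¬Counter (¬ᶠ α) ¬α∈Φ x x⊨¬α α∈x with closed ¬α∈Φ
    ... | α∈Φ ∷ [] = x⊨¬α x (x , id , id , tt) (truth α α∈Φ x α∈x)
    ⊨⇒¬Counter (∼ α) ∼α∈Φ x x⊨∼α (α∈x , ¬∼⊤∈x) with closed ∼α∈Φ
    ... | α∈Φ ∷ [] = x⊨∼α x (x , id , id , ¬∼⊤∈x) (truth α α∈Φ x α∈x)

    -- The search starts from `χ` alone. A derivation passes through the deduction theorem; a world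
    -- omitting `α` would be a point, and the truth lemma would put `α` into it.
    complete : χ ∈ Φ → ∀ {α} → α ∈ Φ → (∀ x → x ⊨ α) → ⊢[ ILM ] (χ ⟶ α)
    complete χ∈Φ {α} α∈Φ valid with search (insert χ∈Φ Subset.⊥) α∈Φ
    ... | inj₁ d = from-∅ (⟶I (weaken (drop ∘ insert-⊑ χ∈Φ) d))
      where
      drop : ⟪ Subset.⊥ ⟫ ▸ χ ⊑ ∅ ▸ χ
      drop = Sum.map₁ λ { (_ , i∈⊥ , _) → ∉⊥ i∈⊥ }
    ... | inj₂ (Δ , ⊆Δ , w , α∉Δ) =
      contradiction (truth⁻¹ α α∈Φ x (valid x)) α∉Δ
      where x = point Δ (⟪⟫-mono ⊆Δ (insert-∈ χ∈Φ)) w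

-- Completeness from the canonical model

module SubformulaModel (α : Formula) where
  Φ = subformulas (¬ᶠ ∼ ⊤ᶠ) ++ subformulas α

  open Canonical Φ (++-closed (subformulas-closed (¬ᶠ ∼ ⊤ᶠ)) (subformulas-closed α)) (here refl) public

  α∈Φ : α ∈ Φ
  α∈Φ = ∈-++⁺ʳ (subformulas (¬ᶠ ∼ ⊤ᶠ)) (here refl)

ILM-complete : ∀ {α} → ValidIn 𝔉₁ α → ⊢[ ILM ] α
ILM-complete {α} valid =
  -- Having no counter, `⊤ᶠ` lies in every world, so this model contains all worlds; being provable,
  -- it can be discharged afterwards.
  mp (complete (there (there (here refl))) α∈Φ (valid frame tt valuation)) (from-∅ ⊤I)
  where
  open SubformulaModel α
  open Model ⊤ᶠ

ILM-complete-∼⊤ : ∀ {α} → ValidIn 𝔉₁′ α → ⊢[ ILM ] (∼ ⊤ᶠ ⟶ α)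
ILM-complete-∼⊤ {α} valid =
  complete (there (here refl)) α∈Φ (valid frame (λ {x} {y} → R₂-empty {x} {y}) valuation)
  where
  open SubformulaModel α
  open Model (∼ ⊤ᶠ)

  R₂-empty : IsN̂′Frame frame
  -- Membership of `∼ ⊤ᶠ` is exactly a counter to `¬ᶠ ∼ ⊤ᶠ`, so no point lies in the upset that
  -- defines `R₂`.
  R₂-empty (z@(point _ ∼⊤∈z _) , _ , _ , ¬∼⊤∈z) = ⊥-elim-irr (∈⇒¬Counter z ¬∼⊤∈z ∼⊤∈z)

-- The one-point frame

-- With the whole frame as upset both relations are total, so `¬ᶠ` and `∼` are interpreted alike.
pointFrame : N̂Frame
pointFrame = upsetFrame ⊤.≡-isPartialOrder U λ _ _ → tt

pointValuation : (ℕ → Bool) → Valuation pointFrame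
pointValuation v = record { V = λ p _ → T (v p) ; upset = λ _ _ → id }

-- Excluded middle settles the formulas of `Φ` one at a time. The continuation form is due to each
-- branch having its own context; `∨E` merges the branches.
by-cases : ∀ {Γ γ} Φ → (∀ α → Γ ⊢ α ∨ ¬ᶠ α) →
  (∀ {Δ} → Γ ⊑ Δ → All (λ α → Δ ⊢ α ⊎ Δ ⊢ ¬ᶠ α) Φ → Δ ⊢ γ) → Γ ⊢ γ
by-cases [] em k = k id []
by-cases (α ∷ Φ) em k = ∨E (em α)
  (by-cases Φ (weaken₁ ∘ em) λ Γα⊆Δ ds → k (Γα⊆Δ ∘ inj₁) (inj₁ (weaken Γα⊆Δ last) ∷ ds))
  (by-cases Φ (weaken₁ ∘ em) λ Γα⊆Δ ds → k (Γα⊆Δ ∘ inj₁) (inj₂ (weaken Γα⊆Δ last) ∷ ds))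

module Kalmár {Γ : Pred Formula 0ℓ} (¬∼⊤ : Γ ⊢ ¬ᶠ ∼ ⊤ᶠ)
  {Φ : List Formula} (closed : SubformulaClosed Φ)
  (literals : All (λ α → Γ ⊢ α ⊎ Γ ⊢ ¬ᶠ α) Φ) where

  assignment : ℕ → Bool
  assignment p with var p ∈? Φ
  -- An arbitrary default: `decide` evaluates only formulas of `Φ`, and their variables are in `Φ`
  -- as well.
  ... | no _ = false
  ... | yes p∈Φ with All.lookup literals p∈Φ
  ...   | inj₁ _ = true
  ...   | inj₂ _ = false

  _holds : Formula → Set
  _holds = Truth pointFrame (pointValuation assignment) tt

  -- Kalmár's lemma, by induction on the formula: the literals settle the variables, and derivations
  -- follow the truth tables.
  decide : ∀ α → α ∈ Φ → (α holds × Γ ⊢ α) ⊎ (¬ α holds × Γ ⊢ ¬ᶠ α)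
  decide (var p) p∈Φ with var p ∈? Φ
  ... | no p∉Φ = contradiction p∈Φ p∉Φ
  ... | yes p∈Φ′ with All.lookup literals p∈Φ′
  ...   | inj₁ d = inj₁ (tt , d)
  ...   | inj₂ d = inj₂ (id , d)
  decide ⊤ᶠ _ = inj₁ (tt , ⊤I)
  decide ⊥ᶠ _ = inj₂ (id , ¬I {β = ⊤ᶠ} (⊥E last) (⊥E last))
  decide (α ∧ β) αβ∈Φ with closed αβ∈Φ
  ... | α∈Φ ∷ β∈Φ ∷ [] with decide α α∈Φ | decide β β∈Φ
  ... | inj₁ (a , d)  | inj₁ (b , e)  = inj₁ ((a , b) , ∧I d e)
  ... | inj₂ (¬a , d) | _             = inj₂ (¬a ∘ proj₁ , ¬I (∧E₁ last) (weaken₁ d))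
  ... | inj₁ _        | inj₂ (¬b , e) = inj₂ (¬b ∘ proj₂ , ¬I (∧E₂ last) (weaken₁ e))
  decide (α ∨ β) αβ∈Φ with closed αβ∈Φ
  ... | α∈Φ ∷ β∈Φ ∷ [] with decide α α∈Φ | decide β β∈Φ
  ... | inj₁ (a , d)  | _             = inj₁ (inj₁ a , ∨I₁ d)
  ... | inj₂ _        | inj₁ (b , e)  = inj₁ (inj₂ b , ∨I₂ e)
  ... | inj₂ (¬a , d) | inj₂ (¬b , e) =
    inj₂ ([ ¬a , ¬b ]′ ,
          ¬I (∨E last last (¬E (weaken₁ (weaken₁ e)) last)) (weaken₁ d))
  decide (α ⟶ β) αβ∈Φ with closed αβ∈Φ
  ... | α∈Φ ∷ β∈Φ ∷ [] with decide α α∈Φ | decide β β∈Φ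
  ... | _             | inj₁ (b , e)  = inj₁ ((λ _ _ _ → b) , const⟶ e)
  ... | inj₂ (¬a , d) | inj₂ _        =
    inj₁ ((λ _ _ a → contradiction a ¬a) , ⟶I (¬E (weaken₁ d) last))
  ... | inj₁ (a , d)  | inj₂ (¬b , e) =
    inj₂ ((λ f → ¬b (f tt refl a)) , ¬I (mp last (weaken₁ d)) (weaken₁ e))
  decide (¬ᶠ α) ¬α∈Φ with closed ¬α∈Φ
  ... | α∈Φ ∷ [] with decide α α∈Φ
  ... | inj₁ (a , d)  = inj₂ ((λ f → f tt (tt , refl , refl , tt) a) , ¬I (weaken₁ d) last)
  ... | inj₂ (¬a , d) = inj₁ ((λ _ _ → ¬a) , d)
  decide (∼ α) ∼α∈Φ with closed ∼α∈Φ
  ... | α∈Φ ∷ [] with decide α α∈Φ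
  -- Together with `α`, assuming `∼ α` gives `¬ᶠ ¬ᶠ ∼ ⊤ᶠ`, against `¬∼⊤`.
  ... | inj₁ (a , d)  = inj₂ ((λ f → f tt (tt , refl , refl , tt) a) ,
                              ¬I (weaken₁ ¬∼⊤) (∼E last (weaken₁ d)))
  ... | inj₂ (¬a , d) = inj₁ ((λ _ _ → ¬a) , ∼I (¬E (weaken₁ d) last))

-- Completeness of `ILM-∨`

ILM-∨-complete-¬∼⊤ : ∀ {α} → ValidIn 𝔉₁′ α → ILM-∨ ▸ ¬ᶠ ∼ ⊤ᶠ ⊢ α
ILM-∨-complete-¬∼⊤ {α} valid = by-cases (subformulas α) em kalmár
  where
  em : ∀ β → ILM-∨ ▸ ¬ᶠ ∼ ⊤ᶠ ⊢ β ∨ ¬ᶠ β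
  -- Under `¬ᶠ ∼ ⊤ᶠ` the disjunct `∼ β` turns into `¬ᶠ β`, since `β` would give `¬ᶠ ¬ᶠ ∼ ⊤ᶠ`.
  em β = ∨E (hyp (inj₁ (∨-∼ β))) (∨I₁ last)
    (∨I₂ (¬I (weaken₁ (weaken₁ last)) (∼E (weaken₁ last) last)))

  kalmár : ∀ {Δ} → ILM-∨ ▸ ¬ᶠ ∼ ⊤ᶠ ⊑ Δ → All (λ β → Δ ⊢ β ⊎ Δ ⊢ ¬ᶠ β) (subformulas α) → Δ ⊢ α
  kalmár ⊆Δ literals =
    [ proj₂ , (λ (¬t , _) → contradiction t ¬t) ]′ (decide α (here refl))
    where
    open Kalmár (weaken ⊆Δ last) (subformulas-closed α) literals
    t : α holds
    t = valid pointFrame (λ _ → refl) (pointValuation assignment) tt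

-- The instance ¬ f ∨ ∼ ¬ f of the axiom, as ∼ ¬ f gives ¬ f → ¬ ¬ f.
∼⊤-em : ILM-∨ ⊢ ∼ ⊤ᶠ ∨ ¬ᶠ ∼ ⊤ᶠ
∼⊤-em = ∨E (hyp (∨-∼ (¬ᶠ ∼ ⊤ᶠ)))
  (∨I₂ last)
  (∨I₁ (∼I (¬I last (∼E (weaken₁ (weaken₁ last)) last))))

ILM-∨-complete : ∀ {α} → ValidIn 𝔉₁′ α → ⊢[ ILM-∨ ] α
ILM-∨-complete valid = map-axioms [ ilm , id ]′
  (∨E ∼⊤-em
    (mp (map-axioms inj₁ (ILM-complete-∼⊤ valid)) last)
    (ILM-∨-complete-¬∼⊤ valid))

theorem4p14 : (α : Formula) → (ValidIn 𝔉₁ α → ⊢[ ILM ] α) × (ValidIn 𝔉₁′ α → ⊢[ ILM-∨ ] α)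
theorem4p14 α = ILM-complete , ILM-∨-complete
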